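{- Let $T$ be a left-linear infinitary term rewriting system and $\psi$ a trivial proof term over $T$, i.e. a proof term containing no occurrence of a rule symbol. Then $\psi\approx src(\psi)$.
   Context: Terms over a finite signature $\Sigma$: finite or infinite trees; $d(t,u)=2^{ -k}$ with $k$ least depth of difference; limits w.r.t. $d$. TRS: left-linear rules $\mu:l\to r$, $l=l[x_1..x_n]$, $r=r[x_1..x_n]$; rule symbol $\mu$ of arity $n$. Multisteps: closed finite/infinite terms over $\Sigma$ and rule symbols; $src$ = normal form under $\mu(\vec x)\to l[\vec x]$; convergent iff a rule-symbol-free normal form under $\mu(\vec x)\to r[\vec x]$ is reached by a strongly convergent reduction ($tgt$ that form); $mind$ minimal depth of a rule symbol ($\omega$ if none). Proof terms: least set of closed terms over $\Sigma$, rule symbols, binary $\cdot$: multisteps; $\cdot_{i<\omega}\psi_i=\psi_0\cdot(\psi_1\cdots)$ for convergent $\psi_i$ with $tgt\psi_i=src\psi_{i+1}$ ($src=src\psi_0$, $tgt=\lim tgt\psi_i$, $mind=\min$, convergent iff $mind\psi_j\to\omega$); $\psi_1\cdot\psi_2$ for convergent $\psi_1$, $tgt\psi_1=src\psi_2$ ($src=src\psi_1$, $tgt=tgt\psi_2$, $mind=\min$); $f(\vec\psi)$ and $\mu(\vec\psi)$ for proof terms not all multisteps ($f$: componentwise, $mind=1+\min$; $\mu$: $src=l[src\psi_i]$, $tgt=r[tgt\psi_i]$, $mind=0$). Basic equations (instances with both sides proof terms): $src(\psi)\cdot\psi=\psi$; $\psi\cdot tgt(\psi)=\psi$ ($\psi$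 convergent); $\psi\cdot(\phi\cdot\chi)=(\psi\cdot\phi)\cdot\chi$; $f(\vec\psi)\cdot f(\vec\phi)=f(\psi_1\cdot\phi_1,..)$; $\cdot_i f(\psi^1_i,..)=f(\cdot_i\psi^1_i,..)$; $\mu(\vec\psi)=\mu(src\psi_1,..)\cdot r[\vec\psi]$; $\mu(\vec\psi)=l[\vec\psi]\cdot\mu(tgt\psi_1,..)$ (all $\psi_i$ convergent). $\approx_E$: least relation on proof terms containing them, closed under reflexivity, symmetry, transitivity, congruence for function symbols, rule symbols, binary and infinite concatenation. $\approx$: least relation containing the basic equations, closed under the same rules and the limit rule: if for every $k<\omega$ there are $\chi_k,\psi'_k,\phi'_k$ with $\psi\approx_E\chi_k\cdot\psi'_k$, $\phi\approx_E\chi_k\cdot\phi'_k$, $mind\psi'_k>k$, $mind\phi'_k>k$, then $\psi\approx\phi$. -}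

module Defs where

open import Data.Nat using (ℕ; zero; suc; _≤_; _<_; _<?_)
open import Data.Nat.Properties using () renaming (_≟_ to _≟ℕ_)
open import Data.Fin using (Fin; toℕ; fromℕ<) renaming (_≟_ to _≟F_)
open import Data.List using (List; []; _∷_; _++_; _∷ʳ_; length)
open import Data.Maybe using (Maybe; just; nothing) renaming (map to mapMaybe)
open import Data.Sum using (_⊎_; inj₁; inj₂) renaming (map₁ to mapInj₁)
open import Data.Product using (Σ; _×_; _,_; ∃)
open import Data.Empty using (⊥)
open import Data.Unit using (⊤)
open import Data.Bool using (Bool; true; false)
open import Relation.Nullary using (¬_; yes; no)
open import Relation.Binary.PropositionalEquality using (_≡_; _≢_)

-- Infinite terms are represented in the classical way, as labellings of
-- positions: a position is a list of child indices read from the root,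
-- and a term assigns to every position either nothing (not a position of
-- the term), a function symbol, or a variable.  (Coinductive types are
-- unavailable: --guardedness is not allowed.)

record Sig : Set₁ where
  field
    Sym : Set
    ar  : Sym → ℕ
open Sig public

record Lab (S : Sig) (V : Set) : Set where
  constructor mkLab
  field
    lab : List ℕ → Maybe (Sym S ⊎ V)
open Lab public

record WFT {S : Sig} {V : Set} (t : Lab S V) : Set where
  field
    rootDefined : Σ (Sym S ⊎ V) λ a → lab t [] ≡ just a
    childDefined : ∀ p i → Σ (Sym S ⊎ V) (λ a → lab t (p ∷ʳ i) ≡ just a)
                   → Σ (Sym S) λ f → lab t p ≡ just (inj₁ f) × i < ar S f
    childExists : ∀ p i (f : Sym S) → lab t p ≡ just (inj₁ f) → i < ar S f
                   → Σ (Sym S ⊎ V) (λ a → lab t (p ∷ʳ i) ≡ just a)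

EqT : {S : Sig} {V : Set} → Lab S V → Lab S V → Set
EqT t u = ∀ p → lab t p ≡ lab u p

-- t and u agree on all positions of depth < k  (i.e. d(t,u) < 2^{-k} or t = u
-- up to the choice of depth convention; d(t,u) ≤ 2^{-k})
Agree : {S : Sig} {V : Set} → ℕ → Lab S V → Lab S V → Set
Agree k t u = ∀ p → length p < k → lab t p ≡ lab u p

Limit : {S : Sig} {V : Set} → (ℕ → Lab S V) → Lab S V → Set
Limit s t = ∀ k → ∃ λ N → ∀ n → N ≤ n → Agree k (s n) t

sub : {S : Sig} {V : Set} → Lab S V → List ℕ → Lab S V
sub t p = mkLab λ q → lab t (p ++ q)

nodeL : {S : Sig} {V : Set} (f : Sym S) → (Fin (ar S f) → Lab S V) → Lab S V
nodeL {S} {V} f ts = mkLab go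
  where
  go : List ℕ → Maybe (Sym S ⊎ V)
  go [] = just (inj₁ f)
  go (i ∷ q) with i <? ar S f
  ... | yes h = lab (ts (fromℕ< h)) q
  ... | no _ = nothing

varL : {S : Sig} {V : Set} → V → Lab S V
varL {S} {V} x = mkLab go
  where
  go : List ℕ → Maybe (Sym S ⊎ V)
  go [] = just (inj₂ x)
  go (_ ∷ _) = nothing

substF : {S : Sig} {V : Set} {n : ℕ} → (List ℕ → Maybe (Sym S ⊎ Fin n)) → (Fin n → Lab S V)
       → List ℕ → Maybe (Sym S ⊎ V)
substF c σ p with c []
substF c σ p | nothing = nothing
substF c σ p | just (inj₂ x) = lab (σ x) p
substF c σ [] | just (inj₁ f) = just (inj₁ f)
substF c σ (i ∷ q) | just (inj₁ f) = substF (λ r → c (i ∷ r)) σ q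

substL : {S : Sig} {V : Set} {n : ℕ} → Lab S (Fin n) → (Fin n → Lab S V) → Lab S V
substL c σ = mkLab (substF (lab c) σ)

repF : {A : Set} → (List ℕ → A) → List ℕ → (List ℕ → A) → List ℕ → A
repF t [] u q = u q
repF t (i ∷ p) u [] = t []
repF t (i ∷ p) u (j ∷ q) with i ≟ℕ j
... | yes _ = repF (λ r → t (i ∷ r)) p u q
... | no _ = t (j ∷ q)

rep : {S : Sig} {V : Set} → Lab S V → List ℕ → Lab S V → Lab S V
rep t p u = mkLab (repF (lab t) p (lab u))

data FTm (S : Sig) (V : Set) : Set where
  fvar : V → FTm S V
  fapp : (f : Sym S) → (Fin (ar S f) → FTm S V) → FTm S V

emb : {S : Sig} {V : Set} → FTm S V → Lab S V
emb (fvar x) = varL x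
emb (fapp f ts) = nodeL f (λ j → emb (ts j))

sumFin : (n : ℕ) → (Fin n → ℕ) → ℕ
sumFin zero g = 0
sumFin (suc n) g = g Fin.zero Data.Nat.+ sumFin n (λ j → g (Fin.suc j))
  where import Data.Fin as Fin
        import Data.Nat

occ : {S : Sig} {n : ℕ} → Fin n → FTm S (Fin n) → ℕ
occ x (fvar y) with x ≟F y
... | yes _ = 1
... | no _ = 0
occ {S} x (fapp f ts) = sumFin (ar S f) (λ j → occ x (ts j))

-- Term rewriting systems over a finite signature Σ = {f : Fin nF}.
-- A rule μ : l → r of arity n has variables x_1..x_n (= Fin n);
-- l is a finite non-variable term, r a (possibly infinite) term.

record TRS : Set₁ where
  field
    nF   : ℕ
    arF  : Fin nF → ℕ
    Rule : Set
    arR  : Rule → ℕ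
    lhsRoot : Rule → Fin nF
    lhsArgs : (μ : Rule) → Fin (arF (lhsRoot μ)) → FTm (record { Sym = Fin nF ; ar = arF }) (Fin (arR μ))
    rhs     : (μ : Rule) → Lab (record { Sym = Fin nF ; ar = arF }) (Fin (arR μ))
    rhsWF   : (μ : Rule) → WFT (rhs μ)

module TRSDefs (T : TRS) where
  open TRS T

  Σ₀ : Sig
  Σ₀ = record { Sym = Fin nF ; ar = arF }

  lhs : (μ : Rule) → FTm Σ₀ (Fin (arR μ))
  lhs μ = fapp (lhsRoot μ) (lhsArgs μ)

  LeftLinear : Set
  LeftLinear = ∀ (μ : Rule) (x : Fin (arR μ)) → occ x (lhs μ) ≡ 1

  arΣR : Fin nF ⊎ Rule → ℕ
  arΣR (inj₁ f) = arF f
  arΣR (inj₂ μ) = arR μ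

  ΣR : Sig
  ΣR = record { Sym = Fin nF ⊎ Rule ; ar = arΣR }

  liftL : {V : Set} → Lab Σ₀ V → Lab ΣR V
  liftL t = mkLab λ p → mapMaybe (mapInj₁ inj₁) (lab t p)

  -- multisteps: closed terms over Σ ∪ rule symbols
  MS : Set
  MS = Lab ΣR ⊥

  Tm₀ : Set
  Tm₀ = Lab Σ₀ ⊥

  -- no rule symbol at a position of depth ≤ k  (i.e. mind > k)
  NoRuleUpTo : ℕ → MS → Set
  NoRuleUpTo k m = ∀ p → length p ≤ k → ∀ (μ : Rule) → lab m p ≢ just (inj₁ (inj₂ μ))

  RuleFree : MS → Set
  RuleFree m = ∀ p (μ : Rule) → lab m p ≢ just (inj₁ (inj₂ μ))

  -- src of a multistep: normal form w.r.t. μ(x⃗) → l[x⃗]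
  -- (computed position by position)
  mutual
    srcF : (List ℕ → Maybe ((Fin nF ⊎ Rule) ⊎ ⊥)) → List ℕ → Maybe (Fin nF ⊎ ⊥)
    srcF m p with m []
    srcF m p | nothing = nothing
    srcF m p | just (inj₂ ())
    srcF m [] | just (inj₁ (inj₁ f)) = just (inj₁ f)
    srcF m (i ∷ q) | just (inj₁ (inj₁ f)) = srcF (λ r → m (i ∷ r)) q
    srcF m [] | just (inj₁ (inj₂ μ)) = just (inj₁ (lhsRoot μ))
    srcF m (i ∷ q) | just (inj₁ (inj₂ μ)) with i <? arF (lhsRoot μ)
    ... | yes h = walkL (lhsArgs μ (fromℕ< h)) m q
    ... | no _ = nothing

    -- walking through l, with the arguments of μ found in the children of m
    walkL : {n : ℕ} → FTm Σ₀ (Fin n) → (List ℕ → Maybe ((Fin nF ⊎ Rule) ⊎ ⊥)) → List ℕ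
          → Maybe (Fin nF ⊎ ⊥)
    walkL (fvar x) m q = srcF (λ r → m (toℕ x ∷ r)) q
    walkL (fapp g ls) m [] = just (inj₁ g)
    walkL (fapp g ls) m (i ∷ q) with i <? arF g
    ... | yes h = walkL (ls (fromℕ< h)) m q
    ... | no _ = nothing

  srcMS : MS → Tm₀
  srcMS m = mkLab (srcF (lab m))

  data Step : ℕ → MS → MS → Set where
    step : {s t : MS} (p : List ℕ) (μ : Rule) → lab s p ≡ just (inj₁ (inj₂ μ))
         → EqT t (rep s p (substL (liftL (rhs μ)) (λ x → sub s (p ∷ʳ toℕ x))))
         → Step (length p) s t

  data FinRed : MS → MS → Set where
    fr-nil  : {s t : MS} → EqT s t → FinRed s t
    fr-cons : {s s' t : MS} {d : ℕ} → Step d s s' → FinRed s' t → FinRed s t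

  OmegaRed : MS → MS → Set
  OmegaRed s t = Σ (ℕ → MS) λ seq → Σ (ℕ → ℕ) λ d →
                   EqT (seq 0) s
                 × (∀ n → Step (d n) (seq n) (seq (suc n)))
                 × (∀ k → ∃ λ N → ∀ n → N ≤ n → k ≤ d n)
                 × Limit seq t

  -- m is convergent with tgt m = t (t rule-symbol free, reached by a strongly
  -- convergent reduction; by compression, length ≤ ω suffices)
  TgtMS : MS → Tm₀ → Set
  TgtMS m t = FinRed m (liftL t) ⊎ OmegaRed m (liftL t)

  infixr 5 _⨾_
  data PT : Set where
    ms  : MS → PT
    _⨾_ : PT → PT → PT
    inf : (ℕ → PT) → PT
    fn  : (f : Fin nF) → (Fin (arF f) → PT) → PT
    rl  : (μ : Rule) → (Fin (arR μ) → PT) → PT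

  IsMS : PT → Set
  IsMS (ms _) = ⊤
  IsMS _ = ⊥

  AllMS : {n : ℕ} → (Fin n → PT) → Set
  AllMS ψ = ∀ i → IsMS (ψ i)

  srcPT : PT → Tm₀
  srcPT (ms m) = srcMS m
  srcPT (ψ ⨾ φ) = srcPT ψ
  srcPT (inf ψ) = srcPT (ψ 0)
  srcPT (fn f ψ) = nodeL {Σ₀} f (λ j → srcPT (ψ j))
  srcPT (rl μ ψ) = substL (emb (lhs μ)) (λ x → srcPT (ψ x))

  MindGt : PT → ℕ → Set
  MindGt (ms m) k = NoRuleUpTo k m
  MindGt (ψ ⨾ φ) k = MindGt ψ k × MindGt φ k
  MindGt (inf ψ) k = ∀ i → MindGt (ψ i) k
  MindGt (fn f ψ) zero = ⊤
  MindGt (fn f ψ) (suc k) = ∀ i → MindGt (ψ i) k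
  MindGt (rl μ ψ) k = ⊥

  Trivial : PT → Set
  Trivial (ms m) = RuleFree m
  Trivial (ψ ⨾ φ) = Trivial ψ × Trivial φ
  Trivial (inf ψ) = ∀ i → Trivial (ψ i)
  Trivial (fn f ψ) = ∀ i → Trivial (ψ i)
  Trivial (rl μ ψ) = ⊥

  data Tgt : PT → Tm₀ → Set where
    tgt-ms  : {m : MS} {t : Tm₀} → TgtMS m t → Tgt (ms m) t
    tgt-cat : {ψ φ : PT} {t : Tm₀} → Tgt φ t → Tgt (ψ ⨾ φ) t
    tgt-inf : {ψ : ℕ → PT} {t : Tm₀} (ts : ℕ → Tm₀)
            → (∀ i → Tgt (ψ i) (ts i))
            → (∀ k → ∃ λ N → ∀ j → N ≤ j → MindGt (ψ j) k)
            → Limit ts t → Tgt (inf ψ) t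
    tgt-fn  : {f : Fin nF} {ψ : Fin (arF f) → PT} {t : Tm₀} (ts : Fin (arF f) → Tm₀)
            → (∀ i → Tgt (ψ i) (ts i)) → EqT t (nodeL {Σ₀} f ts) → Tgt (fn f ψ) t
    tgt-rl  : {μ : Rule} {ψ : Fin (arR μ) → PT} {t : Tm₀} (ts : Fin (arR μ) → Tm₀)
            → (∀ i → Tgt (ψ i) (ts i)) → EqT t (substL (rhs μ) ts) → Tgt (rl μ ψ) t

  Convergent : PT → Set
  Convergent ψ = Σ Tm₀ (Tgt ψ)

  data WF : PT → Set where
    wf-ms  : {m : MS} → WFT m → WF (ms m)
    wf-cat : {ψ φ : PT} → WF ψ → WF φ
           → (Σ Tm₀ λ t → Tgt ψ t × EqT t (srcPT φ)) → WF (ψ ⨾ φ)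
    wf-inf : {ψ : ℕ → PT} → (∀ i → WF (ψ i))
           → (∀ i → Σ Tm₀ λ t → Tgt (ψ i) t × EqT t (srcPT (ψ (suc i)))) → WF (inf ψ)
    wf-fn  : {f : Fin nF} {ψ : Fin (arF f) → PT} → (∀ i → WF (ψ i)) → ¬ AllMS ψ → WF (fn f ψ)
    wf-rl  : {μ : Rule} {ψ : Fin (arR μ) → PT} → (∀ i → WF (ψ i)) → ¬ AllMS ψ → WF (rl μ ψ)

  msLab : PT → MS
  msLab (ms m) = m
  msLab _ = mkLab λ _ → nothing

  Occurs : {n : ℕ} → Fin n → Lab ΣR (Fin n) → Set
  Occurs x c = ∃ λ p → lab c p ≡ just (inj₂ x)

  -- Plug c ψ χ : the proof term χ is c[ψ⃗]
  data Plug : {n : ℕ} → Lab ΣR (Fin n) → (Fin n → PT) → PT → Set where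
    p-var : {n : ℕ} {c : Lab ΣR (Fin n)} {ψ : Fin n → PT} (x : Fin n)
          → lab c [] ≡ just (inj₂ x) → Plug c ψ (ψ x)
    p-fn  : {n : ℕ} {c : Lab ΣR (Fin n)} {ψ : Fin n → PT} (f : Fin nF)
          → lab c [] ≡ just (inj₁ (inj₁ f)) → (χ : Fin (arF f) → PT)
          → (∀ j → Plug (sub c (toℕ j ∷ [])) ψ (χ j)) → ¬ AllMS χ → Plug c ψ (fn f χ)
    p-rl  : {n : ℕ} {c : Lab ΣR (Fin n)} {ψ : Fin n → PT} (μ : Rule)
          → lab c [] ≡ just (inj₁ (inj₂ μ)) → (χ : Fin (arR μ) → PT)
          → (∀ j → Plug (sub c (toℕ j ∷ [])) ψ (χ j)) → ¬ AllMS χ → Plug c ψ (rl μ χ)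
    p-ms  : {n : ℕ} {c : Lab ΣR (Fin n)} {ψ : Fin n → PT} (m : MS)
          → (∀ x → Occurs x c → IsMS (ψ x))
          → EqT m (substL c (λ x → msLab (ψ x))) → Plug c ψ (ms m)

  fctx : (f : Fin nF) → Lab ΣR (Fin (arF f))
  fctx f = nodeL {ΣR} (inj₁ f) varL

  rctx : (μ : Rule) → Lab ΣR (Fin (arR μ))
  rctx μ = nodeL {ΣR} (inj₂ μ) varL

  lctx : (μ : Rule) → Lab ΣR (Fin (arR μ))
  lctx μ = liftL (emb (lhs μ))

  rhsctx : (μ : Rule) → Lab ΣR (Fin (arR μ))
  rhsctx μ = liftL (rhs μ)

  ⌜_⌝ : Tm₀ → PT
  ⌜ t ⌝ = ms (liftL t)

  -- basic equations (sides still to be checked to be proof terms)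

  data BasicEq : PT → PT → Set where
    e-src   : (ψ : PT) → BasicEq (⌜ srcPT ψ ⌝ ⨾ ψ) ψ
    e-tgt   : (ψ : PT) (t : Tm₀) → Tgt ψ t → BasicEq (ψ ⨾ ⌜ t ⌝) ψ
    e-assoc : (ψ φ χ : PT) → BasicEq (ψ ⨾ (φ ⨾ χ)) ((ψ ⨾ φ) ⨾ χ)
    e-fcat  : (f : Fin nF) (ψ φ : Fin (arF f) → PT) (a b c : PT)
            → Plug (fctx f) ψ a → Plug (fctx f) φ b → Plug (fctx f) (λ i → ψ i ⨾ φ i) c
            → BasicEq (a ⨾ b) c
    e-finf  : (f : Fin nF) (ψ : ℕ → Fin (arF f) → PT) (a : ℕ → PT) (c : PT)
            → (∀ n → Plug (fctx f) (ψ n) (a n))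
            → Plug (fctx f) (λ j → inf (λ n → ψ n j)) c
            → BasicEq (inf a) c
    e-rsrc  : (μ : Rule) (ψ : Fin (arR μ) → PT) (a b c : PT)
            → Plug (rctx μ) ψ a
            → Plug (rctx μ) (λ i → ⌜ srcPT (ψ i) ⌝) b
            → Plug (rhsctx μ) ψ c
            → BasicEq a (b ⨾ c)
    e-rtgt  : (μ : Rule) (ψ : Fin (arR μ) → PT) (ts : Fin (arR μ) → Tm₀) (a b c : PT)
            → (∀ i → Tgt (ψ i) (ts i))
            → Plug (rctx μ) ψ a
            → Plug (lctx μ) ψ b
            → Plug (rctx μ) (λ i → ⌜ ts i ⌝) c
            → BasicEq a (b ⨾ c)

  -- Conv false = ≈_E,  Conv true = ≈

  data Conv : Bool → PT → PT → Set where
    c-basic : {b : Bool} {ψ φ : PT} → BasicEq ψ φ → WF ψ → WF φ → Conv b ψ φ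
    -- syntactic identities of the tree representation:
    -- ·_{i<ω} ψ_i is the term ψ_0 · (·_{i<ω} ψ_{i+1}), and multisteps are trees
    c-unfold : {b : Bool} {ψ : ℕ → PT} → WF (inf ψ)
             → Conv b (inf ψ) (ψ 0 ⨾ inf (λ i → ψ (suc i)))
    c-ms    : {b : Bool} {m m' : MS} → WFT m → EqT m m' → Conv b (ms m) (ms m')
    c-refl  : {b : Bool} {ψ : PT} → WF ψ → Conv b ψ ψ
    c-sym   : {b : Bool} {ψ φ : PT} → Conv b ψ φ → Conv b φ ψ
    c-trans : {b : Bool} {ψ φ χ : PT} → Conv b ψ φ → Conv b φ χ → Conv b ψ χ
    c-fn    : {b : Bool} (f : Fin nF) {ψ φ : Fin (arF f) → PT} {a a' : PT}
            → (∀ i → Conv b (ψ i) (φ i))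
            → Plug (fctx f) ψ a → Plug (fctx f) φ a' → WF a → WF a' → Conv b a a'
    c-rl    : {b : Bool} (μ : Rule) {ψ φ : Fin (arR μ) → PT} {a a' : PT}
            → (∀ i → Conv b (ψ i) (φ i))
            → Plug (rctx μ) ψ a → Plug (rctx μ) φ a' → WF a → WF a' → Conv b a a'
    c-cat   : {b : Bool} {ψ ψ' φ φ' : PT} → Conv b ψ ψ' → Conv b φ φ'
            → WF (ψ ⨾ φ) → WF (ψ' ⨾ φ') → Conv b (ψ ⨾ φ) (ψ' ⨾ φ')
    c-inf   : {b : Bool} {ψ φ : ℕ → PT} → (∀ i → Conv b (ψ i) (φ i))
            → WF (inf ψ) → WF (inf φ) → Conv b (inf ψ) (inf φ)
    c-lim   : {ψ φ : PT}
            → (∀ k → Σ PT λ χ → Σ PT λ ψ' → Σ PT λ φ' →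
                   Conv false ψ (χ ⨾ ψ') × Conv false φ (χ ⨾ φ')
                 × MindGt ψ' k × MindGt φ' k)
            → Conv true ψ φ

  _≈E_ : PT → PT → Set
  ψ ≈E φ = Conv false ψ φ

  _≈_ : PT → PT → Set
  ψ ≈ φ = Conv true ψ φ

-- Apply the limit rule with the common prefix χ = src ψ at every depth: the basic equations
-- give ψ ≈E src ψ ⨾ ψ and src ψ ≈E src ψ ⨾ src ψ, and neither ψ nor src ψ contains a rule
-- symbol, so both remainders have mind ψ' > k for every k.
module Submission where

open import Defs

open import Data.Nat using (ℕ; zero; suc; _<_; _<?_)
open import Data.Fin using (Fin)
open import Data.List using (List; []; _∷_; _++_; _∷ʳ_; [_])
open import Data.List.Properties using (++-identityʳ; ++-assoc)
open import Data.Maybe using (Maybe; just; nothing) renaming (map to mapMaybe)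
open import Data.Sum using (_⊎_; inj₁; inj₂) renaming (map₁ to mapInj₁)
open import Data.Product using (Σ; ∃; _×_; _,_; proj₂)
open import Data.Empty using (⊥; ⊥-elim)
open import Data.Unit using (tt)
open import Relation.Nullary using (yes; no)
open import Relation.Binary.PropositionalEquality using (_≡_; _≢_; refl; sym; trans; cong; subst)

PrefixClosed : {A : Set} → (List ℕ → Maybe A) → Set
PrefixClosed {A} m = ∀ p q {a} → m (p ++ q) ≡ just a → ∃ λ (b : A) → m p ≡ just b

prefixClosed-undefined : {A : Set} {m : List ℕ → Maybe A} → PrefixClosed m
                       → m [] ≡ nothing → ∀ q → m q ≡ nothing
prefixClosed-undefined {m = m} pc m[]≡nothing q with m q in mq
... | nothing = refl
... | just a with () ← trans (sym m[]≡nothing) (proj₂ (pc [] q mq))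

module _ {S : Sig} {V : Set} where

  WFT-cong : {t u : Lab S V} → EqT t u → WFT t → WFT u
  WFT-cong {t} {u} t≡u W = record
    { rootDefined = let (a , eq) = WFT.rootDefined W in a , trans (sym (t≡u [])) eq
    ; childDefined = λ p i → λ { (a , eq) →
        let (f , eq' , i<ar) = WFT.childDefined W p i (a , trans (t≡u _) eq)
        in f , trans (sym (t≡u p)) eq' , i<ar }
    ; childExists = λ p i f eq i<ar →
        let (a , eq') = WFT.childExists W p i f (trans (t≡u p) eq) i<ar
        in a , trans (sym (t≡u _)) eq' }

  WFT-prefixClosed : {t : Lab S V} → WFT t → PrefixClosed (lab t)
  WFT-prefixClosed {t} W p [] {a} eq = a , subst (λ r → lab t r ≡ just a) (++-identityʳ p) eq
  WFT-prefixClosed {t} W p (j ∷ q) {a} eq =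
    let (b , eq') = WFT-prefixClosed W (p ∷ʳ j) q
                      (subst (λ r → lab t r ≡ just a) (sym (++-assoc p [ j ] q)) eq)
        (f , eq'' , _) = WFT.childDefined W p j (b , eq')
    in inj₁ f , eq''

  WFT-nodeL : (f : Sym S) (ts : Fin (ar S f) → Lab S V) → (∀ j → WFT (ts j))
            → WFT (nodeL f ts)
  WFT-nodeL f ts W = record
    { rootDefined = inj₁ f , refl
    ; childDefined = childDefined
    ; childExists = childExists }
    where
    childDefined : ∀ p i → Σ (Sym S ⊎ V) (λ a → lab (nodeL f ts) (p ∷ʳ i) ≡ just a)
                 → Σ (Sym S) λ g → lab (nodeL f ts) p ≡ just (inj₁ g) × i < ar S g
    childDefined [] i d with i <? ar S f
    childDefined [] i d | yes i<ar = f , refl , i<ar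
    childDefined [] i (_ , ()) | no _
    childDefined (j ∷ p) i d with j <? ar S f
    childDefined (j ∷ p) i d | yes _ = WFT.childDefined (W _) p i d
    childDefined (j ∷ p) i (_ , ()) | no _

    childExists : ∀ p i (g : Sym S) → lab (nodeL f ts) p ≡ just (inj₁ g) → i < ar S g
                → Σ (Sym S ⊎ V) (λ a → lab (nodeL f ts) (p ∷ʳ i) ≡ just a)
    childExists [] i .f refl i<ar with i <? ar S f
    ... | yes _ = WFT.rootDefined (W _)
    ... | no i≮ar = ⊥-elim (i≮ar i<ar)
    childExists (j ∷ p) i g eq i<ar with j <? ar S f
    childExists (j ∷ p) i g eq i<ar | yes _ = WFT.childExists (W _) p i g eq i<ar
    childExists (j ∷ p) i g () i<ar | no _

module TrivialProofTerms (T : TRS) where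
  open TRS T
  open TRSDefs T

  MSLabel : Set
  MSLabel = Maybe ((Fin nF ⊎ Rule) ⊎ ⊥)

  lift : Maybe (Fin nF ⊎ ⊥) → MSLabel
  lift = mapMaybe (mapInj₁ inj₁)

  -- Junk value: a rule symbol is lowered to `nothing`; it never occurs where this is used.
  lower : MSLabel → Maybe (Fin nF ⊎ ⊥)
  lower nothing = nothing
  lower (just (inj₁ (inj₁ f))) = just (inj₁ f)
  lower (just (inj₁ (inj₂ μ))) = nothing

  lower-lift : ∀ x → lower (lift x) ≡ x
  lower-lift nothing = refl
  lower-lift (just (inj₁ f)) = refl

  lift-lower : ∀ x → (∀ μ → x ≢ just (inj₁ (inj₂ μ))) → lift (lower x) ≡ x
  lift-lower nothing _ = refl
  lift-lower (just (inj₁ (inj₁ f))) _ = refl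
  lift-lower (just (inj₁ (inj₂ μ))) noRule = ⊥-elim (noRule μ refl)

  liftL-ruleFree : (t : Tm₀) → RuleFree (liftL t)
  liftL-ruleFree t p μ with lab t p
  ... | nothing = λ ()
  ... | just (inj₁ f) = λ ()

  srcF-ruleFree : (m : List ℕ → MSLabel) → (∀ p μ → m p ≢ just (inj₁ (inj₂ μ)))
                → PrefixClosed m → ∀ q → srcF m q ≡ lower (m q)
  srcF-ruleFree m noRule pc [] with m [] in m[]
  ... | nothing = refl
  ... | just (inj₁ (inj₁ f)) = refl
  ... | just (inj₁ (inj₂ μ)) = ⊥-elim (noRule [] μ m[])
  srcF-ruleFree m noRule pc (i ∷ q) with m [] in m[]
  ... | nothing = sym (cong lower (prefixClosed-undefined pc m[] (i ∷ q)))
  ... | just (inj₁ (inj₁ f)) =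
        srcF-ruleFree (λ r → m (i ∷ r)) (λ p → noRule (i ∷ p)) (λ p → pc (i ∷ p)) q
  ... | just (inj₁ (inj₂ μ)) = ⊥-elim (noRule [] μ m[])

  liftL-srcMS : (m : MS) → WFT m → RuleFree m → EqT (liftL (srcMS m)) m
  liftL-srcMS m W noRule p =
    trans (cong lift (srcF-ruleFree (lab m) noRule (WFT-prefixClosed W) p))
          (lift-lower (lab m p) (noRule p))

  srcMS-liftL : (t : Tm₀) → WFT (liftL t) → EqT t (srcMS (liftL t))
  srcMS-liftL t W p =
    sym (trans (srcF-ruleFree (lab (liftL t)) (liftL-ruleFree t) (WFT-prefixClosed W) p)
               (lower-lift (lab t p)))

  liftL-nodeL : (f : Fin nF) (ts : Fin (arF f) → Tm₀)
              → EqT (nodeL {ΣR} (inj₁ f) (λ j → liftL (ts j))) (liftL (nodeL {Σ₀} f ts))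
  liftL-nodeL f ts [] = refl
  liftL-nodeL f ts (i ∷ q) with i <? arF f
  ... | yes _ = refl
  ... | no _ = refl

  WFT-liftL-srcPT : (ψ : PT) → WF ψ → Trivial ψ → WFT (liftL (srcPT ψ))
  WFT-liftL-srcPT (ms m) (wf-ms W) noRule = WFT-cong (λ p → sym (liftL-srcMS m W noRule p)) W
  WFT-liftL-srcPT (ψ ⨾ φ) (wf-cat wfψ _ _) (trivψ , _) = WFT-liftL-srcPT ψ wfψ trivψ
  WFT-liftL-srcPT (inf ψ) (wf-inf wfψ _) triv = WFT-liftL-srcPT (ψ 0) (wfψ 0) (triv 0)
  WFT-liftL-srcPT (fn f ψ) (wf-fn wfψ _) triv =
    WFT-cong (liftL-nodeL f (λ j → srcPT (ψ j)))
             (WFT-nodeL (inj₁ f) _ (λ j → WFT-liftL-srcPT (ψ j) (wfψ j) (triv j)))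

  trivial⇒MindGt : (ψ : PT) → Trivial ψ → ∀ k → MindGt ψ k
  trivial⇒MindGt (ms m) noRule k p _ = noRule p
  trivial⇒MindGt (ψ ⨾ φ) (trivψ , trivφ) k = trivial⇒MindGt ψ trivψ k , trivial⇒MindGt φ trivφ k
  trivial⇒MindGt (inf ψ) triv k i = trivial⇒MindGt (ψ i) (triv i) k
  trivial⇒MindGt (fn f ψ) triv zero = tt
  trivial⇒MindGt (fn f ψ) triv (suc k) i = trivial⇒MindGt (ψ i) (triv i) k

  term-tgt : (t : Tm₀) → Tgt ⌜ t ⌝ t
  term-tgt t = tgt-ms (inj₁ (fr-nil (λ _ → refl)))

  ≈E-src⨾ : {ψ : PT} → WF ψ → WFT (liftL (srcPT ψ)) → ψ ≈E (⌜ srcPT ψ ⌝ ⨾ ψ)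
  ≈E-src⨾ {ψ} wfψ W =
    c-sym (c-basic (e-src ψ) (wf-cat (wf-ms W) wfψ (srcPT ψ , term-tgt _ , λ _ → refl)) wfψ)

  ≈E-term⨾term : (t : Tm₀) → WFT (liftL t) → ⌜ t ⌝ ≈E (⌜ t ⌝ ⨾ ⌜ t ⌝)
  ≈E-term⨾term t W =
    c-sym (c-basic (e-tgt ⌜ t ⌝ t (term-tgt t))
                   (wf-cat (wf-ms W) (wf-ms W) (t , term-tgt t , srcMS-liftL t W)) (wf-ms W))

open Defs.TRSDefs

mainTheorem15 : (T : TRS) → LeftLinear T → (ψ : PT T) → WF T ψ → Trivial T ψ
                  → _≈_ T ψ (⌜_⌝ T (srcPT T ψ))
mainTheorem15 T _ ψ wfψ trivψ =
  c-lim λ k → ⌜_⌝ T s , ψ , ⌜_⌝ T s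
            , ≈E-src⨾ wfψ W , ≈E-term⨾term s W
            , trivial⇒MindGt ψ trivψ k , trivial⇒MindGt (⌜_⌝ T s) (liftL-ruleFree s) k
  where
  open TrivialProofTerms T
  s : Tm₀ T
  s = srcPT T ψ
  W : WFT (liftL T s)
  W = WFT-liftL-srcPT ψ wfψ trivψ
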